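{- If there exists a non-principal nowhere dense ultrafilter on $\omega$, then there exists a $\sigma$-centered forcing notion $\mathbb{P}$ such that above every element of $\mathbb{P}$ there are two incompatible elements and $\mathbb{P}$ does not add a Cohen real.
   Context: Forcing order convention: $p\leqslant q$ means $q$ is stronger than $p$. $\mathbb{P}$ is $\sigma$-centered if $\mathbb{P}=\bigcup_{n<\omega}A_n$ with each $A_n$ directed (any two elements of $A_n$ have a common upper bound in $A_n$). $\mathbb{P}$ adds a Cohen real if there is a $\mathbb{P}$-name $\underline{r}$ for an element of ${}^\omega 2$ such that for every ground-model open dense $\mathcal{D}\subseteq{}^\omega 2$, $\Vdash_{\mathbb{P}}\underline{r}\in\mathcal{D}^*$, $\mathcal{D}^*$ being the reinterpretation of $\mathcal{D}$ in the extension. A filter $D$ on $\omega$ is nowhere dense if for every $f\colon\omega\to{}^\omega 2$ there is $A\in D$ with $f(A)$ nowhere dense in ${}^\omega 2$. -}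

module Defs where

open import Level using (0ℓ; suc)
open import Data.Bool.Base using (Bool)
open import Data.Fin.Base using (Fin; toℕ)
open import Data.List.Base using (List; length; lookup)
open import Data.Nat.Base using (ℕ)
open import Data.Product.Base using (Σ; ∃; _×_; _,_; proj₁)
open import Data.Sum.Base using (_⊎_)
open import Function.Bundles using (_⇔_)
open import Relation.Binary.Bundles using (Poset)
open import Relation.Binary.PropositionalEquality using (_≡_; _≢_; _≗_)
open import Relation.Nullary.Negation using (¬_)
open import Relation.Unary
  using (Pred; _∈_; _⊆_; _∩_; _≬_; ∁; U; Empty; Universal; Satisfiable)

-- Properness is stated positively: members are inhabited, not just nonempty.
-- For an ultrafilter this yields excluded middle for Set: apply `ultra` to
-- the constant predicate λ _ → P ⊎ ¬ P. The classical metatheory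
-- therefore does not have to be assumed separately.

record IsFilter (D : Pred (Pred ℕ 0ℓ) 0ℓ) : Set (suc 0ℓ) where
  field
    whole    : U ∈ D
    upward   : ∀ {A B} → A ⊆ B → A ∈ D → B ∈ D
    meet     : ∀ {A B} → A ∈ D → B ∈ D → A ∩ B ∈ D
    nonempty : ∀ {A} → A ∈ D → Satisfiable A

record IsUltrafilter (D : Pred (Pred ℕ 0ℓ) 0ℓ) : Set (suc 0ℓ) where
  field
    isFilter : IsFilter D
    ultra    : ∀ A → A ∈ D ⊎ ∁ A ∈ D

Principal : Pred (Pred ℕ 0ℓ) 0ℓ → Set (suc 0ℓ)
Principal D = ∃ λ n → ∀ A → A ∈ D ⇔ n ∈ A

-- Points are compared by _≗_. Open sets, closures and interiors are
-- automatically invariant under it, since [ s ] is.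

Cantor : Set
Cantor = ℕ → Bool

[_] : List Bool → Pred Cantor 0ℓ
[ s ] x = ∀ (k : Fin (length s)) → x (toℕ k) ≡ lookup s k

interior : Pred Cantor 0ℓ → Pred Cantor 0ℓ
interior X x = ∃ λ s → x ∈ [ s ] × [ s ] ⊆ X

closure : Pred Cantor 0ℓ → Pred Cantor 0ℓ
closure X x = ∀ s → x ∈ [ s ] → [ s ] ≬ X

Open : Pred Cantor 0ℓ → Set
Open X = X ⊆ interior X

Dense : Pred Cantor 0ℓ → Set
Dense X = Universal (closure X)

NowhereDense : Pred Cantor 0ℓ → Set
NowhereDense X = Empty (interior (closure X))

image : (ℕ → Cantor) → Pred ℕ 0ℓ → Pred Cantor 0ℓ
image f A y = ∃ λ n → n ∈ A × f n ≗ y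

IsNowhereDenseFilter : Pred (Pred ℕ 0ℓ) 0ℓ → Set (suc 0ℓ)
IsNowhereDenseFilter D =
  ∀ (f : ℕ → Cantor) → ∃ λ A → A ∈ D × NowhereDense (image f A)

record ForcingNotion : Set (suc 0ℓ) where
  field
    poset     : Poset 0ℓ 0ℓ 0ℓ
    condition : Poset.Carrier poset

-- p ≤ q means that q is stronger than p.

module Forcing (ℙ : ForcingNotion) where

  open Poset (ForcingNotion.poset ℙ) public using (Carrier; _≤_)

  Incompatible : Carrier → Carrier → Set
  Incompatible p q = ¬ (∃ λ r → p ≤ r × q ≤ r)

  Directed : Pred Carrier 0ℓ → Set
  Directed A = ∀ {p q} → p ∈ A → q ∈ A → ∃ λ r → r ∈ A × p ≤ r × q ≤ r

  σ-Centered : Set (suc 0ℓ)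
  σ-Centered = ∃ λ (A : ℕ → Pred Carrier 0ℓ) →
    (∀ p → ∃ λ n → p ∈ A n) × (∀ n → Directed (A n))

  -- A sentence of the forcing language is given by the set of conditions
  -- forcing it. The connectives are the usual clauses in the definition
  -- of the forcing relation; quantifiers range over ground-model sets.

  Sentence : Set (suc 0ℓ)
  Sentence = Pred Carrier 0ℓ

  infix  2 ⊩_
  infixr 4 _∧̇_

  ⊩_ : Sentence → Set
  ⊩ φ = ∀ p → φ p

  _∧̇_ : Sentence → Sentence → Sentence
  (φ ∧̇ ψ) p = φ p × ψ p

  ¬̇_ : Sentence → Sentence
  (¬̇ φ) p = ∀ q → p ≤ q → ¬ φ q

  ∀̇ : {I : Set} → (I → Sentence) → Sentence
  ∀̇ φ p = ∀ i → φ i p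

  ∃̇ : {I : Set} → (I → Sentence) → Sentence
  ∃̇ φ p = ∀ q → p ≤ q → ∃ λ r → q ≤ r × ∃ λ i → φ i r

  -- Names for subsets of a ground-model set X: sets of pairs (x̌ , p). Every
  -- subset of X in the extension has a name of this form.

  Name : Set → Set (suc 0ℓ)
  Name X = Pred (X × Carrier) 0ℓ

  -- q ⊩ x̌ ∈ τ iff the conditions r above some s with (x̌ , s) ∈ τ are dense
  -- above q.

  _∈̇_ : {X : Set} → X → Name X → Sentence
  x ∈̇ τ = ∃̇ λ (i : ∃ λ s → τ (x , s)) r → proj₁ i ≤ r

  -- A real is its graph, a subset of ω × 2.

  IsReal : Name (ℕ × Bool) → Sentence
  IsReal τ =
    ∀̇ (λ n → ∃̇ λ b → (n , b) ∈̇ τ) ∧̇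
    ∀̇ (λ n → ∀̇ λ b → ∀̇ λ c → ∀̇ λ (_ : b ≢ c) →
         ¬̇ ((n , b) ∈̇ τ ∧̇ (n , c) ∈̇ τ))

  _∈̇[_] : Name (ℕ × Bool) → List Bool → Sentence
  τ ∈̇[ s ] = ∀̇ λ (k : Fin (length s)) → (toℕ k , lookup s k) ∈̇ τ

  -- τ ∈ X*: the reinterpretation of an open set X is the union, taken in
  -- the extension, of the basic open sets [ s ] with [ s ] ⊆ X in the
  -- ground model.

  _∈̇_* : Name (ℕ × Bool) → Pred Cantor 0ℓ → Sentence
  τ ∈̇ X * = ∃̇ λ (i : Σ (List Bool) λ s → [ s ] ⊆ X) → τ ∈̇[ proj₁ i ]

  AddsCohenReal : Set (suc 0ℓ)
  AddsCohenReal = ∃ λ (τ : Name (ℕ × Bool)) →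
    (⊩ IsReal τ) × (∀ X → Open X → Dense X → ⊩ τ ∈̇ X *)

{-# OPTIONS --safe #-}

-- The forcing is Laver forcing with a nonprincipal nowhere dense ultrafilter D:
-- a condition is a stem together with a D-large set of successors for every
-- finite sequence; conditions with the same stem are compatible.
--
-- Let τ be a name for a real. Since D is an ultrafilter, a rank argument shows
-- that every stem s decides each digit of τ, which defines a point x s of the
-- Cantor space. As n tends to infinity along D, x (n ∷ s) tends to x s, and
-- { x (n ∷ s) ∣ n ∈ B s } is nowhere dense for some B s ∈ D. For every basic
-- open set [ t ] choose [ hole t ] ⊆ [ t ] missing these sets for the finitely
-- many s coded below the length of t. Shrinking B s so that x (n ∷ s) stays
-- outside the remaining finitely many holes that x s avoids yields a tree all
-- of whose points avoid all holes. The tree forces τ out of the dense open union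
-- of the holes, because a condition with stem s that forces τ ∈ [ t ]
-- has x s ∈ [ t ].

module Submission where

open import Defs
open import Level using (0ℓ)
open import Data.Bool.Base using (Bool; true; false; T; _∧_)
open import Data.Bool.Properties using (T-∧)
import Data.Bool.Properties as Bool
open import Data.Fin.Base using (toℕ; zero; suc)
open import Data.Fin.Properties using (all?; ¬∀⟶∃¬; toℕ<n)
open import Data.List.Base using (List; []; _∷_; length; lookup; applyUpTo)
open import Data.Nat.Base as ℕ using (ℕ; zero; suc; _+_; _<_; s≤s; s<s⁻¹)
open import Data.Nat.Properties
  using (<-≤-connex; ≤-refl; ≤-trans; <-≤-trans; <-irrefl; n≤1+n;
         m≤m+n; m≤n+m; m<1+n⇒m<n∨m≡n)
open import Data.Nat.Binary.Base using (ℕᵇ; zero; 2[1+_]; 1+[2_])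
import Data.Nat.Binary.Base as ℕᵇ
open import Data.Nat.Binary.Properties using (fromℕ-toℕ)
open import Data.Product.Base using (∃; _×_; _,_; proj₁; proj₂)
open import Data.Sum.Base using (_⊎_; inj₁; inj₂; [_,_]′)
open import Data.Unit.Base using (tt)
open import Function.Base using (_∘_; const; id)
open import Function.Bundles using (Equivalence; mk⇔)
open import Relation.Binary.Construct.Interior.Symmetric using (poset)
open import Relation.Binary.Definitions using (Reflexive; Transitive)
open import Relation.Binary.PropositionalEquality
  using (_≡_; _≢_; refl; sym; trans; cong; subst)
open import Relation.Nullary.Decidable
  using (Dec; yes; no; ⌊_⌋; toWitness; fromWitness; decidable-stable)
open import Relation.Nullary.Negation using (¬_; contradiction)
open import Relation.Unary
  using (Pred; _∈_; _∉_; _⊆_; _∩_; Empty)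

-- Coding finite sequences by natural numbers.

-- Bijective binary numerals: each entry `n` becomes `n` digits `2[1+_]` closed by one digit
-- `1+[2_]`.
code : List ℕ → ℕᵇ
code []          = zero
code (zero ∷ s)  = 1+[2 code s ]
code (suc n ∷ s) = 2[1+ code (n ∷ s) ]

decode : ℕᵇ → List ℕ
decode zero      = []
decode 1+[2 b ]  = 0 ∷ decode b
decode 2[1+ b ] with decode b
-- Junk value, never met on the code of a sequence.
... | []    = []
... | n ∷ s = suc n ∷ s

decode-code : ∀ s → decode (code s) ≡ s
decode-code []          = refl
decode-code (zero ∷ s)  = cong (0 ∷_) (decode-code s)
decode-code (suc n ∷ s) rewrite decode-code (n ∷ s) = refl

index : List ℕ → ℕ
index s = ℕᵇ.toℕ (code s)

unindex : ℕ → List ℕ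
unindex i = decode (ℕᵇ.fromℕ i)

unindex-index : ∀ s → unindex (index s) ≡ s
unindex-index s = trans (cong decode (fromℕ-toℕ (code s))) (decode-code s)

-- Points and basic open sets of Cantor space.

point : List Bool → Cantor
point []      _       = false
point (b ∷ t) zero    = b
point (b ∷ t) (suc n) = point t n

point∈ : ∀ t → point t ∈ [ t ]
point∈ (b ∷ t) zero    = refl
point∈ (b ∷ t) (suc k) = point∈ t k

∈-applyUpTo⇒agree : ∀ (y : Cantor) n {z} → z ∈ [ applyUpTo y n ] →
                    ∀ {k} → k < n → z k ≡ y k
∈-applyUpTo⇒agree y (suc n) z∈ {zero}  _   = z∈ zero
∈-applyUpTo⇒agree y (suc n) {z} z∈ {suc k} k<n =
  ∈-applyUpTo⇒agree (y ∘ suc) n {z ∘ suc} (z∈ ∘ suc) (s<s⁻¹ k<n)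

[applyUpTo]⊆ : ∀ (y : Cantor) {n} s → y ∈ [ s ] → length s ℕ.≤ n →
               [ applyUpTo y n ] ⊆ [ s ]
[applyUpTo]⊆ y {n} s y∈ ∣s∣≤n {z} z∈ k =
  trans (∈-applyUpTo⇒agree y n {z} z∈ (<-≤-trans (toℕ<n k) ∣s∣≤n)) (y∈ k)

_∈[_]? : ∀ y t → Dec (y ∈ [ t ])
y ∈[ t ]? = all? (λ k → y (toℕ k) Bool.≟ lookup t k)

-- Trees of finite sequences.

-- Sequences are stored in reverse, so that n ∷ s extends s by n.

Tree : Set
Tree = List ℕ → ℕ → Bool

data Reach (A : Tree) (s : List ℕ) : List ℕ → Set where
  here : Reach A s s
  step : ∀ {t n} → Reach A s t → T (A t n) → Reach A s (n ∷ t)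

_⊑_ : Tree → Tree → Set
B ⊑ A = ∀ u n → T (B u n) → T (A u n)

Reach-mono : ∀ {A B s t} → B ⊑ A → Reach B s t → Reach A s t
Reach-mono B⊑A here       = here
Reach-mono B⊑A (step r n) = step (Reach-mono B⊑A r) (B⊑A _ _ n)

Reach-trans : ∀ {A s t u} → Reach A s t → Reach A t u → Reach A s u
Reach-trans r here        = r
Reach-trans r (step r′ n) = step (Reach-trans r r′) n

Reach-length : ∀ {A s t} → Reach A s t → length s ℕ.≤ length t
Reach-length here       = ≤-refl
Reach-length (step r _) = ≤-trans (Reach-length r) (n≤1+n _)

-- Peeling last entries off `t` leads both paths back to their roots; if only one has ended, the
-- lengths clash.
Reach-siblings : ∀ {A B s t m n} → Reach A (m ∷ s) t → Reach B (n ∷ s) t → m ≡ n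
Reach-siblings here        here        = refl
Reach-siblings here        (step r _)  = contradiction (Reach-length r) (<-irrefl refl)
Reach-siblings (step r _)  here        = contradiction (Reach-length r) (<-irrefl refl)
Reach-siblings (step r _)  (step r′ _) = Reach-siblings r r′

-- Ultrafilter tools and holes of nowhere dense sets.

module _ {D : Pred (Pred ℕ 0ℓ) 0ℓ} (isUltrafilter : IsUltrafilter D) where

  open IsUltrafilter isUltrafilter
  open IsFilter isFilter

  excluded-middle : (P : Set) → Dec P
  excluded-middle P with ultra (λ _ → P)
  ... | inj₁ P∈D  = yes (proj₂ (nonempty P∈D))
  ... | inj₂ ¬P∈D = no (proj₂ (nonempty ¬P∈D))

  -- Trees are Boolean-valued so that conditions form a `Set`; excluded middle brings predicates
  -- into that form.
  χ : Pred ℕ 0ℓ → ℕ → Bool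
  χ A n = ⌊ excluded-middle (A n) ⌋

  χ∈D : ∀ {A} → A ∈ D → T ∘ χ A ∈ D
  χ∈D = upward fromWitness

  χ⁻ : ∀ A {n} → T (χ A n) → n ∈ A
  χ⁻ A = toWitness

  ∃≢ : ¬ Principal D → ∀ {A} → A ∈ D → ∀ n → ∃ λ m → m ∈ A × m ≢ n
  ∃≢ nonprincipal {A} A∈D n with ultra (_≡ n)
  ... | inj₂ ≢n∈D = nonempty (meet A∈D ≢n∈D)
  ... | inj₁ ≡n∈D = contradiction
    (n , λ B → mk⇔
      (λ B∈D → let m , m∈B , m≡n = nonempty (meet B∈D ≡n∈D) in subst B m≡n m∈B)
      (λ n∈B → upward (λ m≡n → subst B (sym m≡n) n∈B) ≡n∈D))
    nonprincipal

  -- Only finitely many strings are involved; the induction splits them by their first bit.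
  ⋂-bounded∈D : ∀ {P : List Bool → Pred ℕ 0ℓ} → (∀ t → P t ∈ D) →
                ∀ m → (λ n → ∀ t → length t ℕ.≤ m → P t n) ∈ D
  ⋂-bounded∈D P∈D zero = upward (λ { p [] _ → p }) (P∈D [])
  ⋂-bounded∈D P∈D (suc m) = upward
    (λ { (p , q , r) []          _         → p
       ; (p , q , r) (false ∷ t) (s≤s t≤m) → q t t≤m
       ; (p , q , r) (true ∷ t)  (s≤s t≤m) → r t t≤m })
    (meet (P∈D [])
      (meet (⋂-bounded∈D (P∈D ∘ (false ∷_)) m) (⋂-bounded∈D (P∈D ∘ (true ∷_)) m)))

  -- Without a hole in `[ t ]`, every point of `[ t ]` would lie in the closure of `X`, giving it
  -- interior.
  NowhereDense⇒hole : ∀ {X} → NowhereDense X → ∀ t →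
                      ∃ λ t′ → [ t′ ] ⊆ [ t ] × Empty ([ t′ ] ∩ X)
  NowhereDense⇒hole {X} nwd t = decidable-stable (excluded-middle _) λ ¬hole →
    nwd (point t) (t , point∈ t , λ {y} y∈t s y∈s →
      -- Long enough for the neighbourhood of `y` to fit in both `[ s ]` and `[ t ]`.
      let n = length s + length t in
      decidable-stable (excluded-middle _) λ s∩X=∅ →
      ¬hole (applyUpTo y n ,
             (λ {z} → [applyUpTo]⊆ y t y∈t (m≤n+m (length t) (length s)) {z}) ,
             λ z (z∈ , z∈X) →
               s∩X=∅ (z , [applyUpTo]⊆ y s y∈s (m≤m+n (length s) (length t)) {z} z∈ , z∈X)))

  NowhereDense⇒common-hole : ∀ {X : ℕ → Pred Cantor 0ℓ} → (∀ i → NowhereDense (X i)) →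
    ∀ m t → ∃ λ t′ → [ t′ ] ⊆ [ t ] × (∀ i → i < m → Empty ([ t′ ] ∩ X i))
  NowhereDense⇒common-hole nwd zero t = t , (λ {_} → id) , λ _ ()
  NowhereDense⇒common-hole {X} nwd (suc m) t
    with t₁ , t₁⊆t , avoid ← NowhereDense⇒common-hole nwd m t
    with t₂ , t₂⊆t₁ , avoidₘ ← NowhereDense⇒hole (nwd m) t₁
    = t₂ , (λ {z} → t₁⊆t {z} ∘ t₂⊆t₁ {z}) , λ i i<1+m y (y∈ , y∈X) →
        [ (λ i<m → avoid i i<m y (t₂⊆t₁ {y} y∈ , y∈X))
        , (λ i≡m → avoidₘ y (y∈ , subst (λ j → y ∈ X j) i≡m y∈X)) ]′
        (m<1+n⇒m<n∨m≡n i<1+m)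

  -- Laver forcing relative to `D`.

  -- `large` ranges over all sequences, so the same tree serves any stem.
  record Condition : Set where
    constructor condition
    field
      stem  : List ℕ
      succs : Tree
      large : ∀ u → T ∘ succs u ∈ D

  open Condition

  record _≼_ (p q : Condition) : Set where
    constructor _,_
    field
      reach  : Reach (succs p) (stem p) (stem q)
      shrink : succs q ⊑ succs p

  ≼-refl : Reflexive _≼_
  ≼-refl = here , λ _ _ → id

  ≼-trans : Transitive _≼_
  ≼-trans (r , q⊑p) (r′ , r⊑q) =
    Reach-trans r (Reach-mono q⊑p r′) , λ u n → q⊑p u n ∘ r⊑q u n

  Laver : ForcingNotion
  Laver = record
    -- Equality of conditions is mutual `≼`, which gives antisymmetry.
    { poset     = poset {R = _≼_} ≼-refl ≼-trans
    ; condition = condition [] (λ _ _ → true) (λ _ → upward (λ _ → tt) whole)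
    }

  open Forcing Laver hiding (Carrier; _≤_)

  amalgamate : ∀ {s A B} a b →
               ∃ λ r → s ≡ stem r × condition s A a ≼ r × condition s B b ≼ r
  amalgamate {s} {A} {B} a b =
    condition s (λ u n → A u n ∧ B u n)
      (λ u → upward (Equivalence.from T-∧) (meet (a u) (b u))) ,
    refl ,
    (here , λ u n → proj₁ ∘ Equivalence.to T-∧) ,
    (here , λ u n → proj₂ ∘ Equivalence.to (T-∧ {A u n}))

  extend : ∀ p {n} → T (succs p (stem p) n) → p ≼ condition (n ∷ stem p) (succs p) (large p)
  extend p n∈ = step here n∈ , λ _ _ → id

  σ-centered : σ-Centered
  σ-centered =
    (λ i p → unindex i ≡ stem p) , (λ p → index (stem p) , unindex-index (stem p)) ,
    λ { _ {condition _ _ a} {condition _ _ b} refl refl → amalgamate a b }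

  incompatible-extensions : ¬ Principal D →
    ∀ p → ∃ λ q → ∃ λ r → p ≼ q × p ≼ r × Incompatible q r
  incompatible-extensions nonprincipal p
    with m , m∈ ← nonempty (large p (stem p))
    with n , n∈ , n≢m ← ∃≢ nonprincipal (large p (stem p)) m
    = _ , _ , extend p m∈ , extend p n∈ ,
      λ (_ , (r , _) , (r′ , _)) → n≢m (Reach-siblings r′ r)

  -- Sentences decided by a stem.

  Persistent : Sentence → Set
  Persistent φ = ∀ {p q} → p ≼ q → φ p → φ q

  -- A ranked substitute for "some condition with stem s forces φ". It passes to
  -- s from a D-large set of successors without amalgamating their conditions.

  data Decides (φ : Sentence) (s : List ℕ) : Set where
    forces : ∀ {A a} → φ (condition s A a) → Decides φ s
    branch : ∀ G → T ∘ G ∈ D → (∀ n → T (G n) → Decides φ (n ∷ s)) → Decides φ s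

  -- Descend through the branches of `Decides ψ s`, moving the stem of the condition for `φ` along;
  -- at a leaf the two conditions share a stem and amalgamate.
  forces-disjoint : ∀ {φ ψ} → Persistent φ → Persistent ψ → (∀ p → φ p → ¬ ψ p) →
                    ∀ {s A a} → φ (condition s A a) → ¬ Decides ψ s
  forces-disjoint φ-persistent ψ-persistent disjoint {a = a} φp (forces {a = b} ψq) =
    let r , _ , p≼r , q≼r = amalgamate a b in
    disjoint r (φ-persistent p≼r φp) (ψ-persistent q≼r ψq)
  forces-disjoint φ-persistent ψ-persistent disjoint {s} {A} {a} φp (branch G G∈D g) =
    let n , n∈A , n∈G = nonempty (meet (a s) G∈D)
        φq = φ-persistent (extend (condition s A a) n∈A) φp
    in forces-disjoint φ-persistent ψ-persistent disjoint φq (g n n∈G)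

  Decides-disjoint : ∀ {φ ψ} → Persistent φ → Persistent ψ → (∀ p → φ p → ¬ ψ p) →
                     ∀ {s} → Decides φ s → ¬ Decides ψ s
  Decides-disjoint φ-persistent ψ-persistent disjoint (forces φp) ψ-decided =
    forces-disjoint φ-persistent ψ-persistent disjoint φp ψ-decided
  Decides-disjoint φ-persistent ψ-persistent disjoint φ-decided (forces ψp) =
    forces-disjoint ψ-persistent φ-persistent (λ p ψp φp → disjoint p φp ψp) ψp φ-decided
  Decides-disjoint φ-persistent ψ-persistent disjoint (branch G G∈D g) (branch H H∈D h) =
    let n , n∈G , n∈H = nonempty (meet G∈D H∈D) in
    Decides-disjoint φ-persistent ψ-persistent disjoint (g n n∈G) (h n n∈H)

  Decides-children : ∀ {φ} → Persistent φ → ∀ {s} → Decides φ s →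
                     (λ n → Decides φ (n ∷ s)) ∈ D
  Decides-children φ-persistent {s} (forces {A} {a} φp) =
    upward (λ n∈ → forces (φ-persistent (extend (condition s A a) n∈) φp)) (a s)
  Decides-children φ-persistent (branch G G∈D g) = upward (g _) G∈D

  module _ {φ ψ : Sentence} (dense : ∀ p → ∃ λ q → p ≼ q × (φ q ⊎ ψ q)) where

    Undecided : Pred (List ℕ) 0ℓ
    Undecided s = ¬ Decides φ s × ¬ Decides ψ s

    ¬Decides-children : ∀ {θ s} → ¬ Decides θ s → (λ n → ¬ Decides θ (n ∷ s)) ∈ D
    ¬Decides-children {θ} {s} ¬θ with ultra (λ n → Decides θ (n ∷ s))
    ... | inj₁ θ∈D  = contradiction (branch (χ _) (χ∈D θ∈D) (λ n → χ⁻ (λ m → Decides θ (m ∷ s)))) ¬θ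
    ... | inj₂ ¬θ∈D = ¬θ∈D

    -- The implication keeps the set large at decided stems too, as a condition requires.
    undecided-large : ∀ s → (λ n → Undecided s → Undecided (n ∷ s)) ∈ D
    undecided-large s with excluded-middle (Undecided s)
    ... | yes (¬φ , ¬ψ) = upward const (meet (¬Decides-children ¬φ) (¬Decides-children ¬ψ))
    ... | no ¬undecided = upward (λ _ undecided → contradiction undecided ¬undecided) whole

    undecided-tree : Tree
    undecided-tree s = χ (λ n → Undecided s → Undecided (n ∷ s))

    Reach-undecided : ∀ {s t} → Reach undecided-tree s t → Undecided s → Undecided t
    Reach-undecided here                = id
    Reach-undecided (step {t} {n} r n∈) =
      χ⁻ (λ n → Undecided t → Undecided (n ∷ t)) n∈ ∘ Reach-undecided r

    -- From an undecided stem the tree leads only to undecided stems, yet density gives an extension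
    -- forcing `φ` or `ψ`, whose stem is therefore decided.
    ¬Undecided : ∀ s → ¬ Undecided s
    ¬Undecided s undecided
      with dense (condition s undecided-tree (λ u → χ∈D (undecided-large u)))
    ... | q , (r , _) , inj₁ φq = proj₁ (Reach-undecided r undecided) (forces φq)
    ... | q , (r , _) , inj₂ ψq = proj₂ (Reach-undecided r undecided) (forces ψq)

  ∃̇-persistent : ∀ {I} {φ : I → Sentence} → Persistent (∃̇ φ)
  ∃̇-persistent p≼q ⊩φ r q≼r = ⊩φ r (≼-trans p≼q q≼r)

  -- A dense open set that a given real avoids.

  module Real (nowhereDense : IsNowhereDenseFilter D)
              (τ : Name (ℕ × Bool)) (isReal : ⊩ IsReal τ) where

    digit : ℕ → Bool → Sentence
    digit k b = (k , b) ∈̇ τ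

    digit-unique : ∀ {k b c s} → Decides (digit k b) s → Decides (digit k c) s → b ≡ c
    digit-unique {k} {b} {c} decides-b decides-c = decidable-stable (b Bool.≟ c) λ b≢c →
      Decides-disjoint ∃̇-persistent ∃̇-persistent
        (λ p ⊩b ⊩c → proj₂ (isReal p) k b c b≢c p ≼-refl (⊩b , ⊩c))
        decides-b decides-c

    digit-dense : ∀ k p → ∃ λ q → p ≼ q × (digit k true q ⊎ digit k false q)
    digit-dense k p with proj₁ (isReal p) k p ≼-refl
    ... | q , p≼q , true  , ⊩b = q , p≼q , inj₁ ⊩b
    ... | q , p≼q , false , ⊩b = q , p≼q , inj₂ ⊩b

    digit-decided : ∀ s k → ∃ λ b → Decides (digit k b) s
    digit-decided s k with excluded-middle (Decides (digit k true) s)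
    ... | yes ⊩true = true , ⊩true
    ... | no ¬⊩true = false , decidable-stable (excluded-middle _) λ ¬⊩false →
      ¬Undecided (digit-dense k) s (¬⊩true , ¬⊩false)

    x : List ℕ → Cantor
    x s k = proj₁ (digit-decided s k)

    x-decided : ∀ s k → Decides (digit k (x s k)) s
    x-decided s k = proj₂ (digit-decided s k)

    x-continuous : ∀ s k → (λ n → x (n ∷ s) k ≡ x s k) ∈ D
    x-continuous s k = upward (λ {n} → digit-unique (x-decided (n ∷ s) k))
      (Decides-children ∃̇-persistent (x-decided s k))

    -- If `x s` is outside `[ t ]`, a single coordinate shows it, and `D`-many children agree with
    -- `x s` there.
    x-avoids : ∀ s t → (λ n → x s ∉ [ t ] → x (n ∷ s) ∉ [ t ]) ∈ D
    x-avoids s t with x s ∈[ t ]?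
    ... | yes x∈ = upward (λ _ x∉ → contradiction x∈ x∉) whole
    ... | no x∉
      with k , k≢ ← ¬∀⟶∃¬ (length t) (λ k → x s (toℕ k) ≡ lookup t k) (λ k → _ Bool.≟ _) x∉
      = upward (λ eq _ x∈ → k≢ (trans (sym eq) (x∈ k))) (x-continuous s (toℕ k))

    children : List ℕ → Pred ℕ 0ℓ
    children s = proj₁ (nowhereDense (λ n → x (n ∷ s)))

    child-points : List ℕ → Pred Cantor 0ℓ
    child-points s = image (λ n → x (n ∷ s)) (children s)

    children∈D : ∀ s → children s ∈ D
    children∈D s = proj₁ (proj₂ (nowhereDense (λ n → x (n ∷ s))))

    child-points-nowhereDense : ∀ s → NowhereDense (child-points s)
    child-points-nowhereDense s = proj₂ (proj₂ (nowhereDense (λ n → x (n ∷ s))))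

    -- The bound divides the work: every stem of index at least `length t` is left to `Successor`,
    -- where it faces only finitely many `t`.
    ∃-hole : ∀ t → ∃ λ t′ → [ t′ ] ⊆ [ t ] × x [] ∉ [ t′ ] ×
             (∀ s → index s < length t → Empty ([ t′ ] ∩ child-points s))
    ∃-hole t =
      let t₁ , t₁⊆t , avoid = NowhereDense⇒common-hole
            (λ i → child-points-nowhereDense (unindex i)) (length t) t
          -- A constant map turns the filter property into nowhere density of the singleton of
          -- `x []`.
          A , A∈D , nwd = nowhereDense (λ _ → x [])
          a , a∈A = nonempty A∈D
          t₂ , t₂⊆t₁ , avoid₀ = NowhereDense⇒hole nwd t₁
      in t₂ , (λ {z} → t₁⊆t {z} ∘ t₂⊆t₁ {z}) ,
         (λ x∈ → avoid₀ (x []) (x∈ , a , a∈A , λ _ → refl)) ,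
         λ s s<t y (y∈ , y∈s) → avoid (index s) s<t y
           (t₂⊆t₁ {y} y∈ , subst (λ u → y ∈ child-points u) (sym (unindex-index s)) y∈s)

    hole : List Bool → List Bool
    hole t = proj₁ (∃-hole t)

    Successor : List ℕ → Pred ℕ 0ℓ
    Successor s n = n ∈ children s ×
      (∀ t → length t ℕ.≤ index s → x s ∉ [ hole t ] → x (n ∷ s) ∉ [ hole t ])

    Successor∈D : ∀ s → Successor s ∈ D
    Successor∈D s =
      meet (children∈D s) (⋂-bounded∈D (λ t → x-avoids s (hole t)) (index s))

    tree : Tree
    tree s = χ (Successor s)

    tree-avoids-holes : ∀ {u} → Reach tree [] u → ∀ t → x u ∉ [ hole t ]
    tree-avoids-holes here t = proj₁ (proj₂ (proj₂ (∃-hole t)))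
    tree-avoids-holes (step {s} {n} r n∈) t =
      let n∈B , keep = χ⁻ (Successor s) n∈ in
      [ (λ s<t x∈ →
          proj₂ (proj₂ (proj₂ (∃-hole t))) s s<t (x (n ∷ s)) (x∈ , n , n∈B , λ _ → refl))
      , (λ t≤s → keep t t≤s (tree-avoids-holes r t)) ]′
      (<-≤-connex (index s) (length t))

    Holes : Pred Cantor 0ℓ
    Holes y = ∃ λ t → y ∈ [ hole t ]

    Holes-open : Open Holes
    Holes-open {y} (t , y∈) = hole t , y∈ , λ {z} z∈ → t , z∈

    Holes-dense : Dense Holes
    Holes-dense y t _ =
      let z = point (hole t); z∈ = point∈ (hole t) in
      z , proj₁ (proj₂ (∃-hole t)) {z} z∈ , t , z∈

    not-Cohen : ¬ (∀ X → Open X → Dense X → ⊩ τ ∈̇ X *)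
    not-Cohen cohen =
      let p = condition [] tree (λ u → χ∈D (Successor∈D u))
          r , (reach , _) , (s , s⊆Holes) , ⊩τ∈s =
            cohen Holes (λ {y} → Holes-open {y}) Holes-dense p p ≼-refl
          -- `r` forces every digit listed in `s`, so by uniqueness `x (stem r)` lies in `[ s ]`,
          -- hence in a hole.
          t , x∈ = s⊆Holes {x (stem r)} λ k →
            digit-unique (x-decided (stem r) (toℕ k)) (forces (⊩τ∈s k))
      in tree-avoids-holes reach t x∈

theorem3 : (∃ λ (D : Pred (Pred ℕ 0ℓ) 0ℓ) →
    IsUltrafilter D × ¬ Principal D × IsNowhereDenseFilter D) →
    ∃ λ (ℙ : ForcingNotion) →
    let open Forcing ℙ in
    σ-Centered ×
    (∀ p → ∃ λ q → ∃ λ r → p ≤ q × p ≤ r × Incompatible q r) ×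
    ¬ AddsCohenReal
theorem3 (D , isUltrafilter , nonprincipal , nowhereDense) =
  Laver isUltrafilter , σ-centered isUltrafilter ,
  incompatible-extensions isUltrafilter nonprincipal ,
  λ (τ , isReal , cohen) → Real.not-Cohen isUltrafilter nowhereDense τ isReal cohen
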